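{- Let $G$ be a signed digraph. If $G$ has no two intersecting (i.e. sharing at least one vertex) cycles with opposite signs, then $G$ is separating.
   Context: A signed digraph $G=(V,E)$ has a finite vertex set $V$ and arc set $E\subseteq V\times V\times\{ -1,1\}$; $(j,i,s)\in E$ is an arc from $j$ to $i$ of sign $s$ (loops allowed, and both a positive and a negative arc from $j$ to $i$ may be present). Cycles and paths are simple subgraphs; the sign of a cycle or path is the product of the signs of its arcs. A configuration is an element of $\{0,1\}^V$; $e_j$ denotes the configuration equal to $1$ exactly at $j$, and $+$ is componentwise addition modulo $2$. A Boolean network (BN) on $V$ is a map $f:\{0,1\}^V\to\{0,1\}^V$. Its signed interaction graph $G(f)$ has vertex set $V$ and a positive (resp. negative) arc from $j$ to $i$ iff there is a configuration $x$ with $x_j=0$ and $f_i(x+e_j)-f_i(x)$ positive (resp. negative). $F(G)$ is the set of BNs $f$ with $G(f)=G$. The asynchronous graph $\Gamma(f)$ has vertex set $\{0,1\}^V$ and an arc $x\to x+e_i$ whenever $f_i(x)\neq x_i$. For a digraph $\Gamma$ on $\{0,1\}^V$, a trap set is a set of configurations with no arc from inside to outside; an attractor is an inclusion-minimal nonempty trap set. A subspace is a set $\{x: x_i=c(i)\ \forall i\in I\}$ for some $I\subseteq V$, $c:I\to\{0,1\}$; $[X]$ is the smallest subspace containing $X$. $\Gamma$ is separating if $[A]\cap[B]=\emptyset$ for all distinct attractors $A,B$. The signed digraph $G$ is called separating if $\Gamma(f)$ is separating for every $f\in F(G)$. -}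

module Defs where

open import Data.Nat using (ℕ; zero; suc)
open import Data.Bool using (Bool; true; false; not)
open import Data.Maybe using (Maybe; just; nothing)
open import Data.Fin using (Fin; zero; suc; inject₁; fromℕ)
open import Data.Vec using (Vec; lookup; _[_]%=_)
open import Data.Product using (Σ; ∃; _×_; _,_)
open import Data.Empty using (⊥)
open import Relation.Nullary using (¬_)
open import Relation.Binary.PropositionalEquality using (_≡_)
open import Level using (Level; _⊔_) renaming (suc to lsuc; zero to lzero)

data Sign : Set where
  pos neg : Sign

_·_ : Sign → Sign → Sign
pos · s = s
neg · pos = neg
neg · neg = pos

prodSign : ∀ {m} → (Fin m → Sign) → Sign
prodSign {zero}  s = pos
prodSign {suc m} s = s zero · prodSign (λ t → s (suc t))

-- Signed digraphs on the vertex set V = Fin n.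
-- G j i s ≡ true  iff  (j , i , s) ∈ E  (arc from j to i of sign s).

SignedDigraph : ℕ → Set
SignedDigraph n = Fin n → Fin n → Sign → Bool

-- A cycle of G: distinct vertices v₀,…,v_len (len+1 ≥ 1 of them) together
-- with, for each consecutive pair (cyclically), a chosen arc of G with its sign.
-- sgn t is the sign of the arc leaving vert t (to vert (t+1), cyclically).
record Cycle {n : ℕ} (G : SignedDigraph n) : Set where
  field
    len     : ℕ
    vert    : Fin (suc len) → Fin n
    sgn     : Fin (suc len) → Sign
    vertInj : ∀ a b → vert a ≡ vert b → a ≡ b
    arcs    : ∀ (t : Fin len) →
              G (vert (inject₁ t)) (vert (suc t)) (sgn (inject₁ t)) ≡ true
    closing : G (vert (fromℕ len)) (vert zero) (sgn (fromℕ len)) ≡ true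

open Cycle public

cycleSign : ∀ {n} {G : SignedDigraph n} → Cycle G → Sign
cycleSign C = prodSign (sgn C)

Intersect : ∀ {n} {G : SignedDigraph n} → Cycle G → Cycle G → Set
Intersect C D = ∃ λ a → ∃ λ b → vert C a ≡ vert D b

NoIntersectingOppositeCycles : ∀ {n} → SignedDigraph n → Set
NoIntersectingOppositeCycles G =
  ∀ (C D : Cycle G) → Intersect C D → cycleSign C ≡ cycleSign D

Config : ℕ → Set
Config n = Vec Bool n

flipAt : ∀ {n} → Config n → Fin n → Config n
flipAt x j = x [ j ]%= not

BN : ℕ → Set
BN n = Config n → Config n

InteractionArc : ∀ {n} → BN n → Fin n → Fin n → Sign → Set
InteractionArc f j i pos =
  ∃ λ x → lookup x j ≡ false × lookup (f x) i ≡ false × lookup (f (flipAt x j)) i ≡ true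
InteractionArc f j i neg =
  ∃ λ x → lookup x j ≡ false × lookup (f x) i ≡ true × lookup (f (flipAt x j)) i ≡ false

InF : ∀ {n} → BN n → SignedDigraph n → Set
InF f G = ∀ j i s → (G j i s ≡ true → InteractionArc f j i s)
                  × (InteractionArc f j i s → G j i s ≡ true)

ConfigGraph : ℕ → Set₁
ConfigGraph n = Config n → Config n → Set

Async : ∀ {n} → BN n → ConfigGraph n
Async f x y = ∃ λ i → ¬ (lookup (f x) i ≡ lookup x i) × y ≡ flipAt x i

ConfigSet : ℕ → Set₁
ConfigSet n = Config n → Set

_⊆_ : ∀ {n} → ConfigSet n → ConfigSet n → Set
A ⊆ B = ∀ x → A x → B x

TrapSet : ∀ {n} → ConfigGraph n → ConfigSet n → Set
TrapSet Γ T = ∀ x y → T x → Γ x y → T y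

Nonempty : ∀ {n} → ConfigSet n → Set
Nonempty A = ∃ λ x → A x

Attractor : ∀ {n} → ConfigGraph n → ConfigSet n → Set₁
Attractor Γ A = Nonempty A × TrapSet Γ A ×
  (∀ (T : ConfigSet _) → Nonempty T → TrapSet Γ T → T ⊆ A → A ⊆ T)

-- a subspace is given by a partial assignment c : I → {0,1}
-- (S i ≡ nothing means i ∉ I)
Subspace : ℕ → Set
Subspace n = Fin n → Maybe Bool

InSub : ∀ {n} → Subspace n → Config n → Set
InSub S x = ∀ i b → S i ≡ just b → lookup x i ≡ b

Span : ∀ {n} → ConfigSet n → ConfigSet n
Span X x = ∀ (S : Subspace _) → (∀ y → X y → InSub S y) → InSub S x

SameSet : ∀ {n} → ConfigSet n → ConfigSet n → Set
SameSet A B = A ⊆ B × B ⊆ A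

SeparatingΓ : ∀ {n} → ConfigGraph n → Set₁
SeparatingΓ Γ = ∀ (A B : ConfigSet _) → Attractor Γ A → Attractor Γ B →
  ¬ SameSet A B → ∀ x → Span A x → Span B x → ⊥

Separating : ∀ {n} → SignedDigraph n → Set₁
Separating G = ∀ (f : BN _) → InF f G → SeparatingΓ (Async f)

{-# OPTIONS --safe #-}
module Submission where

-- Distinct attractors A and B with intersecting spans are shown to contain configurations that
-- agree on ever larger predecessor-closed vertex sets U, hence finally to intersect. Given U, take
-- a source strong component K of the rest. If no positive cycle meets K, two configurations of A
-- and B that agree on U and are closest on K must agree on K, since otherwise the vertices where
-- they differ carry a positive cycle. If a positive cycle meets K, then all closed walks in K are
-- positive, so up to a switch f is monotone on K; each attractor then has a least element on K, and
-- as the spans intersect the least elements of A and B coincide.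

open import Defs
open import Data.Nat using (ℕ; zero; suc; _+_; _≤_; _<_; z≤n; s≤s; z<s)
open import Data.Nat.Properties using (m≤n⇒m≤1+n; m≤n+m; m<m+n; +-monoʳ-<; <-≤-trans; 1+n≰n)
open import Data.Nat.Induction using (<-wellFounded)
open import Induction.WellFounded using (Acc; acc)
open import Data.Bool using (Bool; true; false; not; if_then_else_)
open import Data.Bool.Properties using (¬-not; not-¬; not-involutive) renaming (_≟_ to _≟ᵇ_)
open import Data.Maybe using (just; nothing)
open import Data.Maybe.Properties using (just-injective)
open import Data.Fin using (Fin; zero; suc; inject₁; fromℕ)
open import Data.Fin.Properties using (_≟_; any?; injective⇒≤; sequence)
open import Data.List using ([]; _∷_; allFin)
open import Data.List.Membership.Propositional using (_∈_)
open import Data.List.Membership.Propositional.Properties using (∈-allFin)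
open import Data.List.Relation.Unary.Any using (here; there)
open import Data.Vec using (lookup)
open import Data.Vec.Properties using (lookup∘updateAt; lookup∘updateAt′; updateAt-updateAt; updateAt-id-local)
open import Data.Vec.Relation.Binary.Pointwise.Extensional using (ext; Pointwise-≡⇒≡)
open import Data.Product using (Σ; ∃; ∃-syntax; _×_; _,_; proj₁; proj₂)
open import Data.Sum using (_⊎_; inj₁; inj₂; [_,_]′)
open import Data.Empty using (⊥)
open import Effect.Monad using (RawMonad)
open import Function using (_∘_; id)
open import Relation.Nullary using (¬_; Dec; yes; no; does; contradiction)
open import Relation.Nullary.Decidable using (_×-dec_; _⊎-dec_; ¬?; ¬¬-excluded-middle; decidable-stable)
open import Relation.Nullary.Negation using (¬¬-Monad)
open import Relation.Binary.Construct.Closure.ReflexiveTransitive using (Star; ε; _◅_; _◅◅_)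
open import Relation.Binary.PropositionalEquality using (_≡_; _≢_; refl; sym; trans; cong; cong₂; subst; module ≡-Reasoning)

-- Arithmetic of signs, and truth values read as signs.

·-assoc : ∀ r s t → (r · s) · t ≡ r · (s · t)
·-assoc pos _   _   = refl
·-assoc neg pos _   = refl
·-assoc neg neg pos = refl
·-assoc neg neg neg = refl

·-self : ∀ s → s · s ≡ pos
·-self pos = refl
·-self neg = refl

·-cancelʳ : ∀ {r s} t → r · t ≡ s · t → r ≡ s
·-cancelʳ {pos} {pos} _   _ = refl
·-cancelʳ {neg} {neg} _   _ = refl
·-cancelʳ {pos} {neg} pos ()
·-cancelʳ {pos} {neg} neg ()
·-cancelʳ {neg} {pos} pos ()
·-cancelʳ {neg} {pos} neg ()

·-chain : ∀ r s t → (r · s) · (s · t) ≡ r · t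
·-chain r s t = begin
  (r · s) · (s · t) ≡⟨ ·-assoc r s (s · t) ⟩
  r · (s · (s · t)) ≡⟨ cong (r ·_) (·-assoc s s t) ⟨
  r · ((s · s) · t) ≡⟨ cong (λ p → r · (p · t)) (·-self s) ⟩
  r · t             ∎
  where open ≡-Reasoning

sg : Bool → Sign
sg true  = pos
sg false = neg

sg-not² : ∀ a b → sg (not a) · sg (not b) ≡ sg a · sg b
sg-not² true  true  = refl
sg-not² true  false = refl
sg-not² false true  = refl
sg-not² false false = refl

sg-not≢ : ∀ a b → sg a · sg (not b) ≢ sg a · sg b
sg-not≢ true  true  ()
sg-not≢ true  false ()
sg-not≢ false true  ()
sg-not≢ false false ()

isPos : Sign → Bool
isPos pos = true
isPos neg = false

sg-isPos : ∀ s → sg (isPos s) ≡ s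
sg-isPos pos = refl
sg-isPos neg = refl

-- Sizes of decidable subsets, the measures of the later inductions.

count : ∀ {n} {P : Fin n → Set} → (∀ i → Dec (P i)) → ℕ
count {zero}  P? = 0
count {suc n} P? = (if does (P? zero) then 1 else 0) + count (P? ∘ suc)

count-mono : ∀ {n} {P Q : Fin n → Set} (P? : ∀ i → Dec (P i)) (Q? : ∀ i → Dec (Q i)) →
             (∀ i → P i → Q i) → count P? ≤ count Q?
count-mono {zero}  P? Q? P⊆Q = z≤n
count-mono {suc n} P? Q? P⊆Q with P? zero | Q? zero | count-mono (P? ∘ suc) (Q? ∘ suc) (P⊆Q ∘ suc)
... | yes p | yes _ | ih = s≤s ih
... | yes p | no ¬q | _  = contradiction (P⊆Q zero p) ¬q
... | no _  | yes _ | ih = m≤n⇒m≤1+n ih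
... | no _  | no _  | ih = ih

count-strict : ∀ {n} {P Q : Fin n → Set} (P? : ∀ i → Dec (P i)) (Q? : ∀ i → Dec (Q i)) →
               (∀ i → P i → Q i) → ∀ i → ¬ P i → Q i → count P? < count Q?
count-strict P? Q? P⊆Q zero ¬p q with P? zero | Q? zero
... | yes p | _     = contradiction p ¬p
... | no _  | no ¬q = contradiction q ¬q
... | no _  | yes _ = s≤s (count-mono (P? ∘ suc) (Q? ∘ suc) (P⊆Q ∘ suc))
count-strict P? Q? P⊆Q (suc i) ¬p q
  with P? zero | Q? zero | count-strict (P? ∘ suc) (Q? ∘ suc) (P⊆Q ∘ suc) i ¬p q
... | yes p | yes _ | ih = s≤s ih
... | yes p | no ¬q | _  = contradiction (P⊆Q zero p) ¬q
... | no _  | yes _ | ih = m≤n⇒m≤1+n ih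
... | no _  | no _  | ih = ih

-- Double negation commutes with finite products, so when the goal is `⊥` a relation on finite sets
-- may be treated as decidable.
¬¬-decidable : ∀ {m n} (P : Fin m → Fin n → Set) → ¬ ¬ (∀ i j → Dec (P i j))
¬¬-decidable P = sequence applicative λ _ → sequence applicative λ _ → ¬¬-excluded-middle
  where applicative = RawMonad.rawApplicative ¬¬-Monad

-- Walks and the extraction of simple closed walks.

ArcRel : ℕ → Set₁
ArcRel n = Fin n → Fin n → Sign → Set

-- The arc relation is a parameter because arcs decorated with further conditions are walked along
-- too.
data Walk {n} (R : ArcRel n) : ℕ → Fin n → Fin n → Set where
  []  : ∀ {u} → Walk R 0 u u
  _∷_ : ∀ {k u v w s} → R u v s → Walk R k v w → Walk R (suc k) u w

module _ {n} {R : ArcRel n} where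

  signs : ∀ {k u v} → Walk R k u v → Fin k → Sign
  signs (_∷_ {s = s} _ _) zero    = s
  signs (_ ∷ w)           (suc t) = signs w t

  -- The start vertices of the arcs: the final vertex of the walk is left out.
  verts : ∀ {k u v} → Walk R k u v → Fin k → Fin n
  verts (_∷_ {u = u} _ _) zero    = u
  verts (_ ∷ w)           (suc t) = verts w t

  sign : ∀ {k u v} → Walk R k u v → Sign
  sign w = prodSign (signs w)

  Thru : (Fin n → Set) → ∀ {k u v} → Walk R k u v → Set
  Thru Q w = ∀ t → Q (verts w t)

  Distinct : ∀ {k u v} → Walk R k u v → Set
  Distinct w = ∀ a b → verts w a ≡ verts w b → a ≡ b

  infixr 5 _++_
  _++_ : ∀ {a b u v w} → Walk R a u v → Walk R b v w → Walk R (a + b) u w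
  []      ++ q = q
  (e ∷ p) ++ q = e ∷ (p ++ q)

  sign-++ : ∀ {a b u v w} (p : Walk R a u v) (q : Walk R b v w) → sign (p ++ q) ≡ sign p · sign q
  sign-++ []                q = refl
  sign-++ (_∷_ {s = s} _ p) q = trans (cong (s ·_) (sign-++ p q)) (sym (·-assoc s _ _))

  Thru-∷ : ∀ Q {k u v w s} (e : R u v s) (p : Walk R k v w) → Q u → Thru Q p → Thru Q (e ∷ p)
  Thru-∷ Q e p qu qp zero    = qu
  Thru-∷ Q e p qu qp (suc t) = qp t

  Thru-++⁻ : ∀ Q {a b u v w} (p : Walk R a u v) (q : Walk R b v w) →
             Thru Q (p ++ q) → Thru Q p × Thru Q q
  Thru-++⁻ Q []      q h = (λ ()) , h
  Thru-++⁻ Q (e ∷ p) q h with Thru-++⁻ Q p q (h ∘ suc)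
  ... | hp , hq = Thru-∷ Q e p (h zero) hp , hq

  verts-zero : ∀ {k u v} (w : Walk R (suc k) u v) → verts w zero ≡ u
  verts-zero (_ ∷ _) = refl

  record Occurrence (x : Fin n) {k u v} (w : Walk R k u v) : Set₁ where
    field
      {a b}  : ℕ
      before : Walk R a u x
      after  : Walk R (suc b) x v
      length : a + suc b ≡ k
      signed : sign w ≡ sign before · sign after
      glue   : ∀ Q → Thru Q before → Thru Q after → Thru Q w

  occurrence : ∀ {k u v} (w : Walk R k u v) t → Occurrence (verts w t) w
  occurrence (e ∷ w) zero = record
    { before = [] ; after = e ∷ w ; length = refl ; signed = refl ; glue = λ _ _ h → h }
  occurrence (_∷_ {s = s} e w) (suc t) = record
    { before = e ∷ before ; after = after ; length = cong suc length
    ; signed = trans (cong (s ·_) signed) (sym (·-assoc s _ _))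
    ; glue = λ Q hb ha → Thru-∷ Q e w (hb zero) (glue Q (hb ∘ suc) ha) }
    where open Occurrence (occurrence w t)

  -- `after` has at least one arc, so `loop` alone is shorter than `w`, and `x` is still a start
  -- vertex in the bypass `before ++ after`.
  record Repetition {k u v} (w : Walk R k u v) : Set₁ where
    field
      {a b c} : ℕ
      {x}     : Fin n
      before  : Walk R a u x
      loop    : Walk R (suc b) x x
      after   : Walk R (suc c) x v
      length  : a + (suc b + suc c) ≡ k
      signed  : sign w ≡ sign before · (sign loop · sign after)
      glue    : ∀ Q → Thru Q before → Thru Q loop → Thru Q after → Thru Q w

    loop-shorter : suc b < k
    loop-shorter = subst (suc b <_) length
      (<-≤-trans (m<m+n (suc b) z<s) (m≤n+m _ a))

    bypass-shorter : a + suc c < k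
    bypass-shorter = subst (a + suc c <_) length (+-monoʳ-< a (s≤s (m≤n+m (suc c) b)))

  distinct⊎repetition : ∀ {k u v} (w : Walk R k u v) → Distinct w ⊎ Repetition w
  distinct⊎repetition [] = inj₁ λ ()
  distinct⊎repetition (_∷_ {u = u} {s = s} e w) with distinct⊎repetition w
  ... | inj₂ r = inj₂ record
    { before = e ∷ before ; loop = loop ; after = after ; length = cong suc length
    ; signed = trans (cong (s ·_) signed) (sym (·-assoc s _ _))
    ; glue = λ Q hb hl ha → Thru-∷ Q e w (hb zero) (glue Q (hb ∘ suc) hl ha) }
    where open Repetition r
  ... | inj₁ dist with any? (λ t → verts w t ≟ u)
  ...   | yes (t , refl) = inj₂ record
    { before = [] ; loop = e ∷ before ; after = after ; length = cong suc length
    ; signed = trans (cong (s ·_) signed) (sym (·-assoc s _ _))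
    ; glue = λ Q _ hl ha → Thru-∷ Q e w (hl zero) (glue Q (hl ∘ suc) ha) }
    where open Occurrence (occurrence w t)
  ...   | no ∉w = inj₁ λ where
    zero    zero    _  → refl
    zero    (suc b) eq → contradiction (b , sym eq) ∉w
    (suc a) zero    eq → contradiction (a , eq) ∉w
    (suc a) (suc b) eq → cong suc (dist a b eq)

  SimpleClosed : Set
  SimpleClosed = ∃[ k ] ∃[ u ] Σ (Walk R (suc k) u u) Distinct

  -- A repetition contains a shorter closed walk; descending from loop to loop ends at one without
  -- repetition.
  distinct⊎simpleClosed : ∀ {k u v} (w : Walk R k u v) → Distinct w ⊎ SimpleClosed
  distinct⊎simpleClosed w = go (<-wellFounded _) w
    where
    go : ∀ {k u v} → Acc _<_ k → (w : Walk R k u v) → Distinct w ⊎ SimpleClosed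
    go (acc rec) w with distinct⊎repetition w
    ... | inj₁ d = inj₁ d
    ... | inj₂ r with go (rec (Repetition.loop-shorter r)) (Repetition.loop r)
    ...   | inj₁ d = inj₂ (_ , _ , Repetition.loop r , d)
    ...   | inj₂ c = inj₂ c

  -- Pigeonhole: the start vertices of n + 1 arcs cannot all be distinct.
  long⇒simpleClosed : ∀ {u v} → Walk R (suc n) u v → SimpleClosed
  long⇒simpleClosed w with distinct⊎simpleClosed w
  ... | inj₁ d = contradiction (injective⇒≤ (λ {a} {b} → d a b)) 1+n≰n
  ... | inj₂ c = c

-- Cycles from closed walks, and the signs of closed walks.

Arc : ∀ {n} → SignedDigraph n → ArcRel n
Arc G j i s = G j i s ≡ true

OnCycle : ∀ {n} {G : SignedDigraph n} → Cycle G → Fin n → Set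
OnCycle C v = ∃[ a ] vert C a ≡ v

module _ {n} {G : SignedDigraph n} {R : ArcRel n} (R⊆G : ∀ {j i s} → R j i s → Arc G j i s) where

  inner-arcs : ∀ {k u v} (w : Walk R (suc k) u v) (t : Fin k) →
               Arc G (verts w (inject₁ t)) (verts w (suc t)) (signs w (inject₁ t))
  inner-arcs (e ∷ (_ ∷ _))     zero    = R⊆G e
  inner-arcs (_ ∷ w@(_ ∷ _)) (suc t) = inner-arcs w t

  last-arc : ∀ {k u v} (w : Walk R (suc k) u v) →
             Arc G (verts w (fromℕ k)) v (signs w (fromℕ k))
  last-arc (e ∷ [])        = R⊆G e
  last-arc (_ ∷ w@(_ ∷ _)) = last-arc w

  toCycle : ∀ {k u} (w : Walk R (suc k) u u) → Distinct w → Cycle G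
  toCycle w d = record
    { len = _ ; vert = verts w ; sgn = signs w ; vertInj = d ; arcs = inner-arcs w
    ; closing = subst (λ v → Arc G (verts w (fromℕ _)) v (signs w (fromℕ _))) (sym (verts-zero w)) (last-arc w) }

module _ {n} {G : SignedDigraph n} (H : NoIntersectingOppositeCycles G) where

  AllPositiveAt : Fin n → Set
  AllPositiveAt v = ∀ (C : Cycle G) → OnCycle C v → cycleSign C ≡ pos

  positive⇒allPositive : ∀ (C : Cycle G) {v} → cycleSign C ≡ pos → OnCycle C v → AllPositiveAt v
  positive⇒allPositive C C+ (a , eq) D (b , eq′) = trans (sym (H C D (a , b , trans eq (sym eq′)))) C+

  -- Positivity spreads: once the bypass of a repeated vertex x is known to be positive, all
  -- cycles through x are positive, so the induction also applies to the loop at x.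
  closed-positive : ∀ {k u} (w : Walk (Arc G) k u u) → AllPositiveAt u → sign w ≡ pos
  closed-positive w Qu = proj₁ (go (<-wellFounded _) w Qu)
    where
    go : ∀ {k u} → Acc _<_ k → (w : Walk (Arc G) k u u) → AllPositiveAt u →
         sign w ≡ pos × Thru AllPositiveAt w
    go {zero}  _         []  Qu = refl , λ ()
    go {suc k} (acc rec) w Qu with distinct⊎repetition w
    ... | inj₁ d = C+ , λ t → positive⇒allPositive C C+ (t , refl)
      where
      C  = toCycle id w d
      C+ = Qu C (zero , verts-zero w)
    ... | inj₂ r = trans signed (trans eq bypass+) , glue AllPositiveAt thruBefore (proj₂ loopIH) thruAfter
      where
      open Repetition r
      bypassIH   = go (rec bypass-shorter) (before ++ after) Qu
      thruBefore = proj₁ (Thru-++⁻ AllPositiveAt before after (proj₂ bypassIH))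
      thruAfter  = proj₂ (Thru-++⁻ AllPositiveAt before after (proj₂ bypassIH))
      loopIH     = go (rec loop-shorter) loop (subst AllPositiveAt (verts-zero after) (thruAfter zero))
      bypass+    = trans (sym (sign-++ before after)) (proj₁ bypassIH)
      eq         = cong (λ s → sign before · (s · sign after)) (proj₁ loopIH)

-- Configurations: flips, agreement and spans.

flip-same : ∀ {n} (x : Config n) i → lookup (flipAt x i) i ≡ not (lookup x i)
flip-same x i = lookup∘updateAt i x

flip-other : ∀ {n} (x : Config n) {i j} → j ≢ i → lookup (flipAt x i) j ≡ lookup x j
flip-other x {i} {j} j≢i = lookup∘updateAt′ j i j≢i x

flip-flip : ∀ {n} (x : Config n) i → flipAt (flipAt x i) i ≡ x
flip-flip x i = trans (updateAt-updateAt i x) (updateAt-id-local i x (not-involutive _))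

lookup-ext : ∀ {n} {x y : Config n} → (∀ i → lookup x i ≡ lookup y i) → x ≡ y
lookup-ext eq = Pointwise-≡⇒≡ (ext eq)

≢-third : ∀ {a b c : Bool} → a ≢ b → c ≢ b → a ≡ c
≢-third a≢b c≢b = trans (¬-not a≢b) (sym (¬-not c≢b))

Agree : ∀ {n} → (Fin n → Set) → Config n → Config n → Set
Agree U x y = ∀ i → U i → lookup x i ≡ lookup y i

Meet : ∀ {n} → (Fin n → Set) → ConfigSet n → ConfigSet n → Set
Meet U A B = ∃[ a ] ∃[ b ] A a × B b × Agree U a b

Meet-sym : ∀ {n} {U : Fin n → Set} {A B : ConfigSet n} → Meet U A B → Meet U B A
Meet-sym (a , b , Aa , Bb , eq) = b , a , Bb , Aa , λ i Ui → sym (eq i Ui)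

-- The test subspace fixes coordinate `i` to `c` and leaves all others free.
span-constant : ∀ {n} {X : ConfigSet n} x → Span X x → ∀ i {c} →
                (∀ y → X y → lookup y i ≡ c) → lookup x i ≡ c
span-constant {n} {X} x sp i {c} const = sp at-i inside i c at-i-self
  where
  at-i : Subspace n
  at-i j with j ≟ i
  ... | yes _ = just c
  ... | no _  = nothing
  inside : ∀ y → X y → InSub at-i y
  inside y Xy j b eq with j ≟ i
  ... | yes refl = trans (const y Xy) (just-injective eq)
  inside y Xy j b () | no _
  at-i-self : at-i i ≡ just c
  at-i-self with i ≟ i
  ... | yes _  = refl
  ... | no i≢i = contradiction refl i≢i

-- Asynchronous trajectories and attractors.

module Dynamics {n} (f : BN n) where

  infix 4 _⇝_
  _⇝_ : Config n → Config n → Set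
  _⇝_ = Star (Async f)

  step : ∀ x i → lookup (f x) i ≢ lookup x i → Async f x (flipAt x i)
  step x i ≢x = i , ≢x , refl

  trap-⇝ : ∀ {A} → TrapSet (Async f) A → ∀ {x y} → A x → x ⇝ y → A y
  trap-⇝ trap Ax ε        = Ax
  trap-⇝ trap Ax (e ◅ es) = trap-⇝ trap (trap _ _ Ax e) es

  -- The configurations reachable from `x` form a trap set inside `A`, so by minimality they fill
  -- `A`.
  attractor-connected : ∀ {A} → Attractor (Async f) A → ∀ {x y} → A x → A y → x ⇝ y
  attractor-connected (_ , trap , minimal) {x} Ax Ay =
    minimal (x ⇝_) (x , ε) (λ _ _ xs e → xs ◅◅ (e ◅ ε)) (λ _ → trap-⇝ trap Ax) _ Ay

  attractors-equal : ∀ {A B} → Attractor (Async f) A → Attractor (Async f) B →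
                     ∀ {x} → A x → B x → SameSet A B
  attractors-equal attA attB Ax Bx =
    (λ _ Ay → trap-⇝ (proj₁ (proj₂ attB)) Bx (attractor-connected attA Ax Ay)) ,
    (λ _ By → trap-⇝ (proj₁ (proj₂ attA)) Ax (attractor-connected attB Bx By))

-- Interaction arcs and predecessor-closed vertex sets.

module Network {n} {f : BN n} {G : SignedDigraph n} (f∈F : InF f G) where

  open Dynamics f

  -- The flip negates both the input and the output, hence preserves the product; so the sign may be
  -- read at `x` even when the witness is the flipped configuration.
  flip-arc : ∀ x i j → lookup (f x) i ≢ lookup (f (flipAt x j)) i →
             Arc G j i (sg (lookup x j) · sg (lookup (f x) i))
  flip-arc x i j ≢f with lookup x j in xj | lookup (f x) i in fx
  ... | false | false = proj₂ (f∈F j i pos) (x , xj , fx , ¬-not (≢f ∘ sym))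
  ... | false | true  = proj₂ (f∈F j i neg) (x , xj , fx , ¬-not (≢f ∘ sym))
  ... | true  | false = proj₂ (f∈F j i neg)
    (flipAt x j , trans (flip-same x j) (cong not xj) , ¬-not (≢f ∘ sym) ,
     trans (cong (λ y → lookup (f y) i) (flip-flip x j)) fx)
  ... | true  | true  = proj₂ (f∈F j i pos)
    (flipAt x j , trans (flip-same x j) (cong not xj) , ¬-not (≢f ∘ sym) ,
     trans (cong (λ y → lookup (f y) i) (flip-flip x j)) fx)

  -- Move from `x` to `y` one coordinate at a time. The first flip that changes coordinate `i` of
  -- `f` yields the arc; until then that coordinate equals its value at `x`.
  change-arc : ∀ x y i → lookup (f x) i ≢ lookup (f y) i →
               ∃[ j ] lookup x j ≢ lookup y j × Arc G j i (sg (lookup x j) · sg (lookup (f x) i))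
  change-arc x y i = go (allFin n) x (λ j → inj₂ (∈-allFin j))
    where
    go : ∀ js x → (∀ j → lookup x j ≡ lookup y j ⊎ j ∈ js) → lookup (f x) i ≢ lookup (f y) i →
         ∃[ j ] lookup x j ≢ lookup y j × Arc G j i (sg (lookup x j) · sg (lookup (f x) i))
    go [] x same ≢f = contradiction (cong (λ z → lookup (f z) i) (lookup-ext λ j → [ id , (λ ()) ]′ (same j))) ≢f
    go (k ∷ js) x same ≢f with lookup x k ≟ᵇ lookup y k
    ... | yes xk≡yk = go js x same′ ≢f
      where
      same′ : ∀ j → lookup x j ≡ lookup y j ⊎ j ∈ js
      same′ j with same j
      ... | inj₁ eq           = inj₁ eq
      ... | inj₂ (here refl)  = inj₁ xk≡yk
      ... | inj₂ (there j∈js) = inj₂ j∈js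
    ... | no xk≢yk with lookup (f x) i ≟ᵇ lookup (f (flipAt x k)) i
    ...   | no ≢flip = k , xk≢yk , flip-arc x i k ≢flip
    ...   | yes ≡flip with go js (flipAt x k) same′ (≢f ∘ trans ≡flip)
      where
      same′ : ∀ j → lookup (flipAt x k) j ≡ lookup y j ⊎ j ∈ js
      same′ j with j ≟ k
      ... | yes refl = inj₁ (trans (flip-same x k) (sym (¬-not (xk≢yk ∘ sym))))
      ... | no j≢k with same j
      ...   | inj₁ eq           = inj₁ (trans (flip-other x j≢k) eq)
      ...   | inj₂ (here j≡k)   = contradiction j≡k j≢k
      ...   | inj₂ (there j∈js) = inj₂ j∈js
    -- The vertex found later is not `k`, where the flip already matches `y`; so its value is still
    -- that in `x`.
    ...     | j , ≢y , e with j ≟ k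
    ...       | yes refl = contradiction (trans (flip-same x k) (sym (¬-not (xk≢yk ∘ sym)))) ≢y
    ...       | no j≢k rewrite flip-other x j≢k | ≡flip = j , ≢y , e

  Closed : (Fin n → Set) → Set
  Closed U = ∀ {j i s} → Arc G j i s → U i → U j

  local : ∀ {U} → Closed U → ∀ {x y} → Agree U x y → ∀ {i} → U i → lookup (f x) i ≡ lookup (f y) i
  local cl {x} {y} x≈y {i} Ui = decidable-stable (_ ≟ᵇ _) λ ≢f →
    let (j , ≢xy , e) = change-arc x y i ≢f in ≢xy (x≈y j (cl e Ui))

  module _ {U : Fin n → Set} (U? : ∀ i → Dec (U i)) (U-closed : Closed U) where

    -- Only the moves at vertices of `U` are replayed; they stay possible because `f` on `U` depends
    -- on `U` alone.
    lift : ∀ {x y} → x ⇝ y → ∀ {x′} → Agree U x′ x →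
           ∃[ y′ ] x′ ⇝ y′ × Agree U y′ y × (∀ i → ¬ U i → lookup y′ i ≡ lookup x′ i)
    lift ε {x′} x′≈x = x′ , ε , x′≈x , λ _ _ → refl
    lift {x} ((i , ≢x , refl) ◅ es) {x′} x′≈x with U? i
    ... | yes Ui =
      let (y′ , es′ , y′≈y , same) = lift es flipped
      in y′ , step x′ i ≢x′ ◅ es′ , y′≈y ,
         λ j ¬Uj → trans (same j ¬Uj) (flip-other x′ λ { refl → ¬Uj Ui })
      where
      ≢x′ : lookup (f x′) i ≢ lookup x′ i
      ≢x′ eq = ≢x (trans (sym (local U-closed x′≈x Ui)) (trans eq (x′≈x i Ui)))
      flipped : Agree U (flipAt x′ i) (flipAt x i)
      flipped j Uj with j ≟ i
      ... | yes refl = trans (flip-same x′ i) (trans (cong not (x′≈x i Ui)) (sym (flip-same x i)))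
      ... | no j≢i   = trans (flip-other x′ j≢i) (trans (x′≈x j Uj) (sym (flip-other x j≢i)))
    ... | no ¬Ui = lift es λ j Uj → trans (x′≈x j Uj) (sym (flip-other x λ { refl → ¬Ui Uj }))

    -- Lifting a path of `A` ending at `a` shows that `B` contains the `U`-part of `a`. Lifting a
    -- path of `B` from `b` to such a configuration then installs that part in `b` and freezes the
    -- rest.
    transfer : ∀ {A B} → Attractor (Async f) A → Attractor (Async f) B → Meet U A B →
               ∀ {a b} → A a → B b →
               ∃[ b′ ] B b′ × Agree U b′ a × (∀ i → ¬ U i → lookup b′ i ≡ lookup b i)
    transfer attA attB (a₀ , b₀ , Aa₀ , Bb₀ , a₀≈b₀) Aa Bb =
      let (_ , es₁ , b₁≈a , _) = lift (attractor-connected attA Aa₀ Aa) (λ i Ui → sym (a₀≈b₀ i Ui))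
          Bb₁ = trap-⇝ (proj₁ (proj₂ attB)) Bb₀ es₁
          (b′ , es , b′≈b₁ , same) = lift (attractor-connected attB Bb Bb₁) (λ _ _ → refl)
      in b′ , trap-⇝ (proj₁ (proj₂ attB)) Bb es , (λ i Ui → trans (b′≈b₁ i Ui) (b₁≈a i Ui)) , same

    -- From `U` to `W` when no positive cycle meets the new vertices.

    module _ {W : Fin n → Set} (W? : ∀ i → Dec (W i)) (W-closed : Closed W) where

      Inside : Fin n → Set
      Inside i = W i × ¬ U i

      Differ : Config n → Config n → Fin n → Set
      Differ a b i = W i × lookup a i ≢ lookup b i

      Differ? : ∀ a b i → Dec (Differ a b i)
      Differ? a b i = W? i ×-dec ¬? (lookup a i ≟ᵇ lookup b i)

      flip-Differ : ∀ a b i → Differ a b i → ∀ j → Differ (flipAt a i) b j → Differ a b j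
      flip-Differ a b i (_ , ≢i) j (Wj , ≢j) with j ≟ i
      ... | yes refl = Wj , ≢i
      ... | no j≢i   = Wj , ≢j ∘ trans (flip-other a j≢i)

      flip-¬Differ : ∀ a b i → Differ a b i → ¬ Differ (flipAt a i) b i
      flip-¬Differ a b i (_ , ≢i) (_ , ≢) = ≢ (trans (flip-same a i) (sym (¬-not (≢i ∘ sym))))

      flip-Agree : ∀ a b i → Agree U a b → Differ a b i → Agree U (flipAt a i) b
      flip-Agree a b i a≈b (_ , ≢i) j Uj =
        trans (flip-other a λ { refl → ≢i (a≈b j Uj) }) (a≈b j Uj)

      flip-count : ∀ a b i → Differ a b i → count (Differ? (flipAt a i) b) < count (Differ? a b)
      flip-count a b i d = count-strict (Differ? (flipAt a i) b) (Differ? a b) (flip-Differ a b i d) i (flip-¬Differ a b i d) d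

      -- Every differing vertex has a differing in-neighbour, and the arc has the sign that makes
      -- a cycle of such arcs telescope to a positive one.
      stuck⇒positiveCycle : ∀ {a b} → Agree U a b →
        (∀ i → Differ a b i → lookup (f a) i ≡ lookup a i) →
        (∀ i → Differ a b i → lookup (f b) i ≡ lookup b i) →
        ∃ (Differ a b) →
        ∃[ C ] cycleSign {G = G} C ≡ pos × (∃[ u ] OnCycle C u × Inside u)
      stuck⇒positiveCycle {a} {b} a≈b fixa fixb (d , Dd) =
        fromSimple (long⇒simpleClosed (proj₂ (proj₂ (long (suc n)))))
        where
        R : ArcRel n
        R j i s = Arc G j i s × Differ a b j × s ≡ sg (lookup a j) · sg (lookup a i)

        pred : ∀ i → Differ a b i → ∃[ j ] ∃[ s ] R j i s
        pred i Di@(Wi , ≢i) =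
          let (j , ≢j , e) = change-arc a b i λ eq → ≢i (trans (sym (fixa i Di)) (trans eq (fixb i Di)))
          in j , _ , e , (W-closed e Wi , ≢j) , cong (λ c → sg (lookup a j) · sg c) (fixa i Di)

        long : ∀ k → ∃[ j ] Differ a b j × Walk R k j d
        long zero    = d , Dd , []
        long (suc k) =
          let (i , Di , w) = long k
              (j , s , e)  = pred i Di
          in j , proj₁ (proj₂ e) , e ∷ w

        telescope : ∀ {k u v} (w : Walk R k u v) → sign w ≡ sg (lookup a u) · sg (lookup a v)
        telescope {u = u} [] = sym (·-self (sg (lookup a u)))
        telescope (_∷_ {u = u} {v} {w} (_ , _ , s≡) p) =
          trans (cong₂ _·_ s≡ (telescope p)) (·-chain (sg (lookup a u)) (sg (lookup a v)) (sg (lookup a w)))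

        start : ∀ {k u v} → Walk R (suc k) u v → Differ a b u
        start ((_ , Du , _) ∷ _) = Du

        fromSimple : SimpleClosed {R = R} →
          ∃[ C ] cycleSign {G = G} C ≡ pos × (∃[ u ] OnCycle C u × Inside u)
        fromSimple (_ , u , w , dist) =
          toCycle proj₁ w dist , trans (telescope w) (·-self (sg (lookup a u))) ,
          u , (zero , verts-zero w) , proj₁ (start w) , λ Uu → proj₂ (start w) (a≈b u Uu)

      Differ-sym : ∀ {a b i} → Differ a b i → Differ b a i
      Differ-sym (Wi , ≢i) = Wi , ≢i ∘ sym

      -- Flipping an unstable differing vertex, in `a` or in `b`, removes one difference and stays
      -- in the attractor. When no such vertex is left, any remaining difference would give a
      -- positive cycle.
      meet-nonpositive : ∀ {A B} → TrapSet (Async f) A → TrapSet (Async f) B →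
        ¬ (∃[ C ] cycleSign {G = G} C ≡ pos × (∃[ u ] OnCycle C u × Inside u)) →
        Meet U A B → Meet W A B
      meet-nonpositive {A} {B} trapA trapB ¬C (a , b , Aa , Bb , a≈b) = go (<-wellFounded _) Aa Bb a≈b
        where
        go : ∀ {a b} → Acc _<_ (count (Differ? a b)) → A a → B b → Agree U a b → Meet W A B
        go {a} {b} (acc rec) Aa Bb a≈b
          with any? (λ i → Differ? a b i ×-dec ¬? (lookup (f a) i ≟ᵇ lookup a i))
        ... | yes (i , Di , ≢a) =
          go (rec (flip-count a b i Di)) (trapA _ _ Aa (step a i ≢a)) Bb (flip-Agree a b i a≈b Di)
        ... | no fixa with any? (λ i → Differ? a b i ×-dec ¬? (lookup (f b) i ≟ᵇ lookup b i))
        ...   | yes (i , Di , ≢b) =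
          go (rec fewer) Aa (trapB _ _ Bb (step b i ≢b))
             (λ j Uj → sym (flip-Agree b a i (λ k Uk → sym (a≈b k Uk)) (Differ-sym {a} {b} Di) j Uj))
          where
          fewer : count (Differ? a (flipAt b i)) < count (Differ? a b)
          fewer = count-strict (Differ? a (flipAt b i)) (Differ? a b)
            (λ j Dj → Differ-sym {b} {a} (flip-Differ b a i (Differ-sym {a} {b} Di) j (Differ-sym {a} {flipAt b i} Dj)))
            i (flip-¬Differ b a i (Differ-sym {a} {b} Di) ∘ Differ-sym {a} {flipAt b i}) Di
        ...   | no fixb with any? (Differ? a b)
        ...     | no same = a , b , Aa , Bb , λ i Wi → decidable-stable (_ ≟ᵇ _) λ ≢i → same (i , Wi , ≢i)
        ...     | yes D = contradiction
          (stuck⇒positiveCycle a≈b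
            (λ i Di → decidable-stable (_ ≟ᵇ _) λ ≢a → fixa (i , Di , ≢a))
            (λ i Di → decidable-stable (_ ≟ᵇ _) λ ≢b → fixb (i , Di , ≢b)) D) ¬C

      -- Balanced signs on the new vertices: monotonicity and least elements.

      Balanced : (Fin n → Bool) → Set
      Balanced τ = ∀ {j i s} → Arc G j i s → Inside j → Inside i → s ≡ sg (τ j) · sg (τ i)

      balanced-not : ∀ {τ} → Balanced τ → Balanced (not ∘ τ)
      balanced-not {τ} bal {j} {i} e Ij Ii = trans (bal e Ij Ii) (sym (sg-not² (τ j) (τ i)))

      -- x ≤ y for the componentwise order on Inside in which τ i is the smaller value at i.
      Below : (Fin n → Bool) → Config n → Config n → Set
      Below τ x y = ∀ i → Inside i → lookup y i ≡ τ i → lookup x i ≡ τ i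

      -- A failure would produce an arc from some `j` with `x` equal to `τ j` there, whose sign is
      -- opposite to the one that balance prescribes.
      monotone : ∀ {τ} → Balanced τ → ∀ {x y} → Agree U x y → Below τ x y →
                 ∀ i → Inside i → lookup (f y) i ≡ τ i → lookup (f x) i ≡ τ i
      monotone {τ} bal {x} {y} x≈y x≤y i Ii fy≡ = decidable-stable (_ ≟ᵇ _) λ fx≢ →
        let (j , ≢j , e) = change-arc x y i (λ eq → fx≢ (trans eq fy≡))
            Ij  = W-closed e (proj₁ Ii) , λ Uj → ≢j (x≈y j Uj)
            xj≡ = decidable-stable (_ ≟ᵇ _) λ xj≢ → xj≢ (x≤y j Ij (≢-third (≢j ∘ sym) (xj≢ ∘ sym)))
        in sg-not≢ (τ j) (τ i)
             (trans (cong₂ (λ c d → sg c · sg d) (sym xj≡) (sym (¬-not fx≢))) (bal e Ij Ii))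

      -- No change of the values on `U` within `B` enables a move lowering `q` at a new vertex. The
      -- range over all such `b` is what lets `U` keep evolving.
      Floor : (Fin n → Bool) → ConfigSet n → Config n → Set
      Floor τ B q = ∀ b → B b → (∀ i → ¬ U i → lookup b i ≡ lookup q i) →
                    ∀ i → Inside i → lookup (f b) i ≡ τ i → lookup q i ≡ τ i

      -- If `q` is no floor, some `b` with the same values off `U` can be lowered at a new vertex,
      -- and the number of high vertices drops. Membership in `B` is not decidable, hence the double
      -- negation.
      ¬¬floor : ∀ τ {B} → TrapSet (Async f) B → Nonempty B → ¬ ¬ (∃[ q ] B q × Floor τ B q)
      ¬¬floor τ {B} trapB (b , Bb) none = go (<-wellFounded _) Bb
        where
        High? : ∀ x i → Dec (Inside i × lookup x i ≢ τ i)
        High? x i = (W? i ×-dec ¬? (U? i)) ×-dec ¬? (lookup x i ≟ᵇ τ i)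

        go : ∀ {q} → Acc _<_ (count (High? q)) → B q → ⊥
        go {q} (acc rec) Bq = none (q , Bq , λ b Bb same i Ii fb≡ →
          decidable-stable (_ ≟ᵇ _) λ q≢ →
            let b≢ : lookup b i ≢ τ i
                b≢ eq = q≢ (trans (sym (same i (proj₂ Ii))) eq)
                low : lookup (flipAt b i) i ≡ τ i
                low = trans (flip-same b i) (sym (¬-not (b≢ ∘ sym)))
                shrink : ∀ j → Inside j × lookup (flipAt b i) j ≢ τ j → Inside j × lookup q j ≢ τ j
                shrink j (Ij , ≢j) = Ij , λ qj≡ → ≢j (trans (flip-other b λ { refl → q≢ qj≡ })
                                                        (trans (same j (proj₂ Ij)) qj≡))
            in go (rec (count-strict (High? (flipAt b i)) (High? q) shrink i (λ h → proj₂ h low) (Ii , q≢)))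
                  (trapB _ _ Bb (step b i λ eq → b≢ (trans (sym eq) fb≡))))

      -- A move of z below the floor q would be matched, by monotonicity, by a move of the
      -- configuration of B that agrees with z on U and with q elsewhere.
      floor-below : ∀ {τ} → Balanced τ → ∀ {A B} → Attractor (Async f) A → Attractor (Async f) B →
                    Meet U A B → ∀ {q} → B q → Floor τ B q →
                    ∀ {p} → A p → Below τ q p → ∀ {z} → A z → Below τ q z
      floor-below {τ} bal {A} attA attB meet {q} Bq floor Ap q≤p Az =
        go Ap q≤p (attractor-connected attA Ap Az)
        where
        go : ∀ {p z} → A p → Below τ q p → p ⇝ z → Below τ q z
        go Ap q≤p ε = q≤p
        go {p} Ap q≤p (_◅_ {j = p′} (k , ≢p , refl) es) =
          go (proj₁ (proj₂ attA) p p′ Ap (step p k ≢p)) q≤p′ es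
          where
          q≤p′ : Below τ q (flipAt p k)
          q≤p′ i Ii p′i≡ with i ≟ k
          ... | no i≢k = q≤p i Ii (trans (sym (flip-other p i≢k)) p′i≡)
          ... | yes refl =
            let (b , Bb , b≈p , same) = transfer attA attB meet Ap Bq
                fp≡ = trans (¬-not ≢p) (trans (sym (flip-same p k)) p′i≡)
                b≤p = λ j Ij pj≡ → trans (same j (proj₂ Ij)) (q≤p j Ij pj≡)
            in floor b Bb same i Ii (monotone bal b≈p b≤p i Ii fp≡)

      -- The floor `q` lies below all of `B` and the ceiling `p` above all of `A`. Were `p` low and
      -- `q` high at a vertex, `A` and `B` would be constant there with opposite values, which the
      -- common point `x` of the spans forbids.
      floors-ordered : ∀ {τ} → Balanced τ → ∀ {A B} → Attractor (Async f) A → Attractor (Async f) B →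
        Meet U A B → ∀ x → Span A x → Span B x →
        ∀ {p} → A p → Floor (not ∘ τ) A p → ∀ {q} → B q → Floor τ B q →
        ∀ {z} → A z → Below τ q z
      floors-ordered {τ} bal {A} {B} attA attB meet x xA xB {p} Ap ceil {q} Bq floor =
        floor-below bal attA attB meet Bq floor Ap λ i Ii pi≡ →
          decidable-stable (_ ≟ᵇ _) λ qi≢ →
            not-¬ (span-constant x xA i (λ y Ay → decidable-stable (_ ≟ᵇ _) λ yi≢ →
                     not-¬ pi≡ (floor-below {not ∘ τ} (balanced-not {τ} bal) attA attA self-A Ap ceil Ap
                                  (λ _ _ eq → eq) Ay i Ii (¬-not yi≢))))
                  (span-constant x xB i (λ y By → ¬-not λ yi≡ →
                     qi≢ (floor-below bal attB attB self-B Bq floor Bq (λ _ _ eq → eq) By i Ii yi≡)))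
        where
        self-A : Meet U A A
        self-A = p , p , Ap , Ap , λ _ _ → refl
        self-B : Meet U B B
        self-B = q , q , Bq , Bq , λ _ _ → refl

      -- The two floors lie below each other, so they agree on the new vertices; `transfer` then
      -- equips `qB` with the `U`-part of `qA`.
      meet-balanced : ∀ {τ} → Balanced τ → ∀ {A B} → Attractor (Async f) A → Attractor (Async f) B →
        ∀ x → Span A x → Span B x → Meet U A B → ¬ ¬ Meet W A B
      meet-balanced {τ} bal {A} {B} attA@(neA , trapA , _) attB@(neB , trapB , _) x xA xB meet k =
        ¬¬floor τ trapA neA λ (qA , AqA , floorA) →
        ¬¬floor τ trapB neB λ (qB , BqB , floorB) →
        ¬¬floor (not ∘ τ) trapA neA λ (pA , ApA , ceilA) →
        ¬¬floor (not ∘ τ) trapB neB λ (pB , BpB , ceilB) →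
        let qB≤qA = floors-ordered bal attA attB meet x xA xB ApA ceilA BqB floorB AqA
            qA≤qB = floors-ordered bal attB attA (Meet-sym meet) x xB xA BpB ceilB AqA floorA BqB
            (b , Bb , b≈qA , same) = transfer attA attB meet AqA BqB
        in k (qA , b , AqA , Bb , agree qA qB b qB≤qA qA≤qB b≈qA same)
        where
        agree : ∀ qA qB b → Below τ qB qA → Below τ qA qB → Agree U b qA →
                (∀ i → ¬ U i → lookup b i ≡ lookup qB i) → Agree W qA b
        agree qA qB b qB≤qA qA≤qB b≈qA same i Wi with U? i
        ... | yes Ui = sym (b≈qA i Ui)
        ... | no ¬Ui with lookup qA i ≟ᵇ τ i
        ...   | yes eq = trans eq (sym (trans (same i ¬Ui) (qB≤qA i (Wi , ¬Ui) eq)))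
        ...   | no ≢τ  = trans (≢-third ≢τ (≢τ ∘ qA≤qB i (Wi , ¬Ui))) (sym (same i ¬Ui))

      -- A balancing switch from walks out of `u` and back.

      module _ (H : NoIntersectingOppositeCycles G) {u} (Qu : AllPositiveAt H u)
               (from : ∀ i → Inside i → ∃[ k ] Walk (Arc G) k u i)
               (to   : ∀ i → Inside i → ∃[ k ] Walk (Arc G) k i u) where

        -- The sign of a chosen walk from `u`; the value `true` off the new vertices is a dummy.
        potential : Fin n → Bool
        potential i with W? i ×-dec ¬? (U? i)
        ... | yes Ii = isPos (sign (proj₂ (from i Ii)))
        ... | no _   = true

        -- The chosen walk followed by `w` is closed at `u`, hence positive.
        potential-back : ∀ i → Inside i → ∀ {k} (w : Walk (Arc G) k i u) → sg (potential i) · sign w ≡ pos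
        potential-back i Ii w with W? i ×-dec ¬? (U? i)
        ... | no ¬Ii  = contradiction Ii ¬Ii
        ... | yes Ii′ = begin
          sg (isPos (sign p)) · sign w ≡⟨ cong (_· sign w) (sg-isPos (sign p)) ⟩
          sign p · sign w              ≡⟨ sign-++ p w ⟨
          sign (p ++ w)                ≡⟨ closed-positive H (p ++ w) Qu ⟩
          pos                          ∎
          where
          open ≡-Reasoning
          p = proj₂ (from i Ii′)

        -- Compare a walk `w` from `i` to `u` with `e ∷ w` from `j`: their signs are the two
        -- potentials and differ by the factor `s`.
        potential-balanced : Balanced potential
        potential-balanced {j} {i} {s} e Ij Ii = solve (sg (potential j)) (sg (potential i)) s (sign w)
          (potential-back j Ij (e ∷ w)) (potential-back i Ii w)
          where
          w = proj₂ (to i Ii)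
          solve : ∀ p q s t → p · (s · t) ≡ pos → q · t ≡ pos → s ≡ p · q
          solve p q s t eq₁ eq₂ = ·-cancelʳ t (begin
            s · t             ≡⟨ cong (_· (s · t)) (·-self p) ⟨
            (p · p) · (s · t) ≡⟨ ·-assoc p p (s · t) ⟩
            p · (p · (s · t)) ≡⟨ cong (p ·_) (trans eq₁ (sym eq₂)) ⟩
            p · (q · t)       ≡⟨ ·-assoc p q t ⟨
            (p · q) · t       ∎)
            where open ≡-Reasoning

  -- Source components and the induction on `U`.

  Reaches : Fin n → Fin n → Set
  Reaches j i = ∃[ k ] Walk (Arc G) k j i

  reaches-trans : ∀ {i j k} → Reaches i j → Reaches j k → Reaches i k
  reaches-trans (_ , p) (_ , q) = _ , p ++ q

  -- Adding all ancestors of `v` keeps the set predecessor-closed; for `v` in a source component of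
  -- the rest, only that component is new.
  Extend : (Fin n → Set) → Fin n → Fin n → Set
  Extend U v i = U i ⊎ Reaches i v

  extend-closed : ∀ {U} → Closed U → ∀ v → Closed (Extend U v)
  extend-closed U-closed v e (inj₁ Ui)      = inj₁ (U-closed e Ui)
  extend-closed U-closed v e (inj₂ (_ , w)) = inj₂ (_ , e ∷ w)

  module _ (H : NoIntersectingOppositeCycles G) {A B : ConfigSet n}
           (attA : Attractor (Async f) A) (attB : Attractor (Async f) B)
           (A≢B : ¬ SameSet A B) x (xA : Span A x) (xB : Span B x)
           (reaches? : ∀ j i → Dec (Reaches j i)) where

    extend? : ∀ {U : Fin n → Set} → (∀ i → Dec (U i)) → ∀ v i → Dec (Extend U v i)
    extend? U? v i = U? i ⊎-dec reaches? i v

    -- The existence of a positive cycle need not be decided: given the refutation `k`, the balanced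
    -- case is absurd, so the other case applies.
    meet-extend : ∀ {U} (U? : ∀ i → Dec (U i)) → Closed U → Meet U A B →
      ∀ v → (∀ w → ¬ U w → Reaches w v → Reaches v w) →
      ¬ ¬ Meet (Extend U v) A B
    meet-extend {U} U? U-closed meet v source k =
      k (meet-nonpositive U? U-closed W? W-closed (proj₁ (proj₂ attA)) (proj₁ (proj₂ attB)) noPositive meet)
      where
      W : Fin n → Set
      W = Extend U v

      W? : ∀ i → Dec (W i)
      W? = extend? U? v

      W-closed : Closed W
      W-closed = extend-closed U-closed v

      toV : ∀ {i} → W i × ¬ U i → Reaches i v
      toV (inj₁ Ui , ¬Ui) = contradiction Ui ¬Ui
      toV (inj₂ r  , _)   = r

      fromV : ∀ {i} → W i × ¬ U i → Reaches v i
      fromV Ii = source _ (proj₂ Ii) (toV Ii)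

      noPositive : ¬ (∃[ C ] cycleSign {G = G} C ≡ pos × (∃[ u ] OnCycle C u × W u × ¬ U u))
      noPositive (C , C+ , u , onC , Iu) =
        meet-balanced U? U-closed W? W-closed
          {potential U? U-closed W? W-closed H Qu from to}
          (potential-balanced U? U-closed W? W-closed H Qu from to) attA attB x xA xB meet k
        where
        Qu   = positive⇒allPositive H C C+ onC
        from = λ i Ii → reaches-trans (toV Iu) (fromV Ii)
        to   = λ i Ii → reaches-trans (toV Ii) (fromV Iu)

    -- Induction on the complement of `U`; once it is empty, the two configurations coincide and so
    -- do the attractors.
    meet-absurd : ∀ {U} (U? : ∀ i → Dec (U i)) → Acc _<_ (count (¬? ∘ U?)) → Closed U → ¬ Meet U A B
    meet-absurd {U} U? (acc rec) U-closed meet with any? (¬? ∘ U?)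
    ... | yes (v , ¬Uv) = go (<-wellFounded _) ¬Uv
      where
      go : ∀ {v} → Acc _<_ (count (λ w → reaches? w v)) → ¬ U v → ⊥
      go {v} (acc rec′) ¬Uv with any? (λ w → ¬? (U? w) ×-dec reaches? w v ×-dec ¬? (reaches? v w))
      -- Passing to `w` loses the ancestor `v`, so this search ends in a source component.
      ... | yes (w , ¬Uw , w→v , v↛w) =
        go (rec′ (count-strict (λ i → reaches? i w) (λ i → reaches? i v)
                    (λ i i→w → reaches-trans i→w w→v) v v↛w (0 , []))) ¬Uw
      ... | no source =
        meet-extend U? U-closed meet v
          (λ w ¬Uw w→v → decidable-stable (reaches? v w) λ v↛w → source (w , ¬Uw , w→v , v↛w))
          (meet-absurd W? (rec fewer) (extend-closed U-closed v))
        where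
        W? : ∀ i → Dec (Extend U v i)
        W? = extend? U? v
        fewer : count (¬? ∘ W?) < count (¬? ∘ U?)
        fewer = count-strict (¬? ∘ W?) (¬? ∘ U?) (λ _ ¬Wi → ¬Wi ∘ inj₁) v (λ ¬Wv → ¬Wv (inj₂ (0 , []))) ¬Uv
    ... | no full =
      let (a , b , Aa , Bb , a≈b) = meet
          a≡b = lookup-ext λ i → a≈b i (decidable-stable (U? i) λ ¬Ui → full (i , ¬Ui))
      in A≢B (attractors-equal attA attB Aa (subst B (sym a≡b) Bb))

theorem9 : ∀ {n : ℕ} (G : SignedDigraph n) →
    NoIntersectingOppositeCycles G → Separating G
theorem9 {n} G H f f∈F A B attA@((a , Aa) , _) attB@((b , Bb) , _) A≢B x xA xB =
  ¬¬-decidable Reaches λ reaches? →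
    -- The empty set is predecessor-closed, and any two configurations agree on it.
    meet-absurd H attA attB A≢B x xA xB reaches? {λ _ → ⊥} (λ _ → no λ ()) (<-wellFounded _) (λ _ ())
      (a , b , Aa , Bb , λ _ ())
  where
  open Network f∈F
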